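{- For every integer $n\ge 0$, \[ \sum_{k=-\infty}^{\infty}(-1)^k\,\overline{p}_o\!\left(n-\frac{k(3k+1)}{2}\right)=\begin{cases}(-1)^{\lceil m/2\rceil}, & \text{if } n=\frac{m(3m+1)}{2} \text{ for some } m\in\mathbb{Z},\\ 0, & \text{otherwise}.\end{cases} \]
   Context: An overpartition of a nonnegative integer $n$ is a partition of $n$ in which the first occurrence of each part size may be overlined. $\overline{p}_o(n)$ denotes the number of overpartitions of $n$ into odd parts; equivalently $\sum_{n\ge0}\overline{p}_o(n)q^n=\frac{(-q;q^2)_\infty}{(q;q^2)_\infty}$, where $(a;q)_\infty=\prod_{k\ge1}(1-aq^{k-1})$. Convention: $\overline{p}_o(x)=0$ whenever $x$ is not a nonnegative integer. -}

module Defs where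

open import Data.Nat as ℕ using (ℕ; zero; suc; _∸_; _≤_)
open import Data.Nat.DivMod using (_/_; _%_)
open import Data.Integer as ℤ using (ℤ; +_; -[1+_]; _-_; -_)
open import Relation.Nullary using (yes; no)

-- ovOdd k n = number of overpartitions of n whose parts all lie in
-- {1, 3, ..., 2k-1}.  Built part-size by part-size: the part size 2k+1
-- occurs with multiplicity 0 (1 way) or multiplicity m ≥ 1 (2 ways:
-- its first occurrence overlined or not).
mutual
  ovOdd : ℕ → ℕ → ℕ
  ovOdd zero zero = 1
  ovOdd zero (suc _) = 0
  ovOdd (suc k) n = ovOdd k n ℕ.+ 2 ℕ.* withPart k (ℕ.suc (2 ℕ.* k)) n n

  -- Σ_{m ≥ 1, m*p ≤ n} ovOdd k (n ∸ m*p), computed with fuel = n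
  -- (enough since p ≥ 1).
  withPart : ℕ → ℕ → ℕ → ℕ → ℕ
  withPart k p zero n = 0
  withPart k p (suc fuel) n with p ℕ.≤? n
  ... | yes _ = ovOdd k (n ∸ p) ℕ.+ withPart k p fuel (n ∸ p)
  ... | no _ = 0

-- p̄_o(n): overpartitions of n into odd parts (odd parts ≤ 2n-1 suffice).
pbarO : ℕ → ℕ
pbarO n = ovOdd n n

pbarOℤ : ℤ → ℤ
pbarOℤ (+ n) = + pbarO n
pbarOℤ -[1+ _ ] = + 0

pent : ℤ → ℕ
pent (+ a) = (a ℕ.* (3 ℕ.* a ℕ.+ 1)) / 2
pent -[1+ b ] = (suc b ℕ.* (3 ℕ.* b ℕ.+ 2)) / 2   -- k = -(b+1): (b+1)(3b+2)/2

negOnePow : ℤ → ℤ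
negOnePow c with ℤ.∣ c ∣ % 2
... | zero = + 1
... | suc _ = ℤ.-[1+ 0 ]

ceilHalf : ℤ → ℤ
ceilHalf (+ a) = + ((suc a) / 2)
ceilHalf -[1+ b ] = - (+ ((suc b) / 2))

symSum : ℕ → (ℤ → ℤ) → ℤ
symSum zero f = f (+ 0)
symSum (suc N) f = symSum N f ℤ.+ f (+ suc N) ℤ.+ f -[1+ N ]

term : ℕ → ℤ → ℤ
term n k = negOnePow k ℤ.* pbarOℤ (+ n - + pent k)

{-# OPTIONS --safe #-}
module Submission where

-- Write O for the generating function ∏ (1 + q²ⁱ⁻¹) / (1 - q²ⁱ⁻¹). Multiplying it by
-- ∏ (1 - qⁱ) cancels the odd factors of the denominator and leaves ∏ (1 - (-q)ⁱ); with
-- parts bounded by 2k - 1 and 2k factors this is an exact identity of series. Both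
-- products are expanded by Euler's pentagonal number theorem, at q and at -q, in Shanks'
-- finite form
--   Σ_{k=0}^{n} (-1)ᵏ (1 - qᵏ⁺¹) ⋯ (1 - qⁿ) q^(nk + k(k+1)/2) = Σ_{k=-n}^{n} (-1)ᵏ q^(k(3k+1)/2),
-- whose left side is ∏_{i ≤ n} (1 - qⁱ) modulo qⁿ⁺¹ and which telescopes in n. Polynomials
-- in q act on integer sequences, so no product of power series is needed.

open import Defs
open import Data.Nat using (ℕ; zero; suc; _≤_; _<_; _∸_; z≤n; s≤s; z<s; s<s)
import Data.Nat as ℕ
import Data.Nat.Properties as ℕ
open import Data.Nat.DivMod using (_/_; _%_; m*n/n≡m; +-distrib-/-∣ˡ)
open import Data.Nat.Divisibility using (∣-refl)
open import Data.Nat.Tactic.RingSolver using () renaming (solve-∀ to ℕ-solve-∀)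
open import Data.Integer using (ℤ; +_; -[1+_]; _+_; _-_; _*_; -_; _^_; ∣_∣; 0ℤ; 1ℤ; -1ℤ)
open import Data.Integer.Properties
  using (*-zeroʳ; *-identityˡ; *-identityʳ; +-identityʳ; ^-distribˡ-+-*; ^-zeroˡ; ^-*-assoc;
         m-n≡m⊖n; ⊖-≥; ⊖-<; pos-+)
open import Data.Integer.Tactic.RingSolver using (solve-∀)
open import Data.Product using (_×_; _,_)
open import Data.Sum using (inj₁; inj₂)
open import Relation.Binary.Definitions using (tri<; tri≈; tri>)
open import Relation.Binary.PropositionalEquality
  using (_≡_; _≢_; _≗_; refl; sym; trans; cong; cong₂; subst; module ≡-Reasoning)
open import Relation.Nullary using (yes; no; contradiction)

-- Integer sequences under the action of polynomials in q.

Series : Set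
Series = ℕ → ℤ

-- Multiplication by qᵃ; recursion on both arguments fills in zeros without truncated subtraction.
shift : ℕ → Series → Series
shift zero    f n       = f n
shift (suc a) f zero    = 0ℤ
shift (suc a) f (suc n) = shift a f n

shift-cong : ∀ a {f g} → f ≗ g → shift a f ≗ shift a g
shift-cong zero    eq n       = eq n
shift-cong (suc a) eq zero    = refl
shift-cong (suc a) eq (suc n) = shift-cong a eq n

shift-linear : ∀ a f c g n →
  shift a (λ i → f i - c * g i) n ≡ shift a f n - c * shift a g n
shift-linear zero    f c g n       = refl
shift-linear (suc a) f c g zero    = sym (cong (λ z → 0ℤ - z) (*-zeroʳ c))
shift-linear (suc a) f c g (suc n) = shift-linear a f c g n

shift-shift : ∀ a b f n → shift a (shift b f) n ≡ shift (a ℕ.+ b) f n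
shift-shift zero    b f n       = refl
shift-shift (suc a) b f zero    = refl
shift-shift (suc a) b f (suc n) = shift-shift a b f n

shift-comm : ∀ a b f n → shift a (shift b f) n ≡ shift b (shift a f) n
shift-comm a b f n = begin
  shift a (shift b f) n ≡⟨ shift-shift a b f n ⟩
  shift (a ℕ.+ b) f n   ≡⟨ cong (λ e → shift e f n) (ℕ.+-comm a b) ⟩
  shift (b ℕ.+ a) f n   ≡⟨ shift-shift b a f n ⟨
  shift b (shift a f) n ∎
  where open ≡-Reasoning

shift-< : ∀ {a n} f → n < a → shift a f n ≡ 0ℤ
shift-< {suc a} {zero}  f _         = refl
shift-< {suc a} {suc n} f (s<s n<a) = shift-< f n<a

shift-≥ : ∀ {a n} f → a ≤ n → shift a f n ≡ f (n ∸ a)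
shift-≥ {zero}          f _         = refl
shift-≥ {suc a} {suc n} f (s≤s a≤n) = shift-≥ f a≤n

-- mono c a f is (c q)ᵃ f, and factor c a f is (1 - (c q)ᵃ) f.
mono : ℤ → ℕ → Series → Series
mono c a f n = c ^ a * shift a f n

factor : ℤ → ℕ → Series → Series
factor c a f n = f n - mono c a f n

mono-cong : ∀ c a {f g} → f ≗ g → mono c a f ≗ mono c a g
mono-cong c a eq n = cong (c ^ a *_) (shift-cong a eq n)

mono-< : ∀ c {a n} f → n < a → mono c a f n ≡ 0ℤ
mono-< c {a} f n<a = trans (cong (c ^ a *_) (shift-< f n<a)) (*-zeroʳ (c ^ a))

mono-1 : ∀ a f → mono 1ℤ a f ≗ shift a f
mono-1 a f n = trans (cong (_* shift a f n) (^-zeroˡ a)) (*-identityˡ _)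

mono-factor : ∀ c a b f n → mono c a (factor c b f) n ≡ mono c a f n - mono c (a ℕ.+ b) f n
mono-factor c a b f n = begin
  c ^ a * shift a (factor c b f) n
    ≡⟨ cong (c ^ a *_) (shift-linear a f (c ^ b) (shift b f) n) ⟩
  c ^ a * (shift a f n - c ^ b * shift a (shift b f) n)
    ≡⟨ distrib (c ^ a) (c ^ b) (shift a f n) (shift a (shift b f) n) ⟩
  mono c a f n - c ^ a * c ^ b * shift a (shift b f) n
    ≡⟨ cong₂ (λ x y → mono c a f n - x * y)
         (sym (^-distribˡ-+-* c a b)) (shift-shift a b f n) ⟩
  mono c a f n - mono c (a ℕ.+ b) f n ∎
  where
  open ≡-Reasoning
  distrib : ∀ x y u v → x * (u - y * v) ≡ x * u - x * y * v
  distrib = solve-∀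

factor-cong : ∀ c a {f g} → f ≗ g → factor c a f ≗ factor c a g
factor-cong c a eq n = cong₂ _-_ (eq n) (mono-cong c a eq n)

factor-comm : ∀ c a d b f → factor c a (factor d b f) ≗ factor d b (factor c a f)
factor-comm c a d b f n = begin
  factor c a (factor d b f) n
    ≡⟨ expand c a d b ⟩
  f n - d ^ b * shift b f n - c ^ a * (shift a f n - d ^ b * shift a (shift b f) n)
    ≡⟨ cong (λ z → f n - d ^ b * shift b f n - c ^ a * (shift a f n - d ^ b * z))
         (shift-comm a b f n) ⟩
  f n - d ^ b * shift b f n - c ^ a * (shift a f n - d ^ b * shift b (shift a f) n)
    ≡⟨ rearrange (f n) (c ^ a) (d ^ b) (shift a f n) (shift b f n) _ ⟩
  f n - c ^ a * shift a f n - d ^ b * (shift b f n - c ^ a * shift b (shift a f) n)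
    ≡⟨ expand d b c a ⟨
  factor d b (factor c a f) n ∎
  where
  open ≡-Reasoning
  expand : ∀ c a d b → factor c a (factor d b f) n
    ≡ f n - d ^ b * shift b f n - c ^ a * (shift a f n - d ^ b * shift a (shift b f) n)
  expand c a d b = cong (λ z → factor d b f n - c ^ a * z)
    (shift-linear a f (d ^ b) (shift b f) n)
  rearrange : ∀ z x y u v w →
    z - y * v - x * (u - y * w) ≡ z - x * u - y * (v - x * w)
  rearrange = solve-∀

-- ∏_{i = k+1}^{k+d} (1 - (c q)ⁱ) · f
factors : ℤ → ℕ → ℕ → Series → Series
factors c k zero    f = f
factors c k (suc d) f = factor c (suc (k ℕ.+ d)) (factors c k d f)

factors-cong : ∀ c k d {f g} → f ≗ g → factors c k d f ≗ factors c k d g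
factors-cong c k zero    eq = eq
factors-cong c k (suc d) eq = factor-cong c (suc (k ℕ.+ d)) (factors-cong c k d eq)

factors-factor : ∀ c k d e a f →
  factors c k d (factor e a f) ≗ factor e a (factors c k d f)
factors-factor c k zero    e a f n = refl
factors-factor c k (suc d) e a f n =
  trans (factor-cong c (suc (k ℕ.+ d)) (factors-factor c k d e a f) n)
        (factor-comm c (suc (k ℕ.+ d)) e a (factors c k d f) n)

-- `factors` unfolds from its top factor, while the telescoping also has to detach the lowest one;
-- this is possible because factors commute.
factors-lowest : ∀ c k d f →
  factors c k (suc d) f ≗ factor c (suc k) (factors c (suc k) d f)
factors-lowest c k zero f n =
  cong (λ i → factor c (suc i) f n) (ℕ.+-identityʳ k)
factors-lowest c k (suc d) f n = begin
  factor c (suc (k ℕ.+ suc d)) (factors c k (suc d) f) n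
    ≡⟨ factor-cong c (suc (k ℕ.+ suc d)) (factors-lowest c k d f) n ⟩
  factor c (suc (k ℕ.+ suc d)) (factor c (suc k) g) n
    ≡⟨ factor-comm c (suc (k ℕ.+ suc d)) c (suc k) g n ⟩
  factor c (suc k) (factor c (suc (k ℕ.+ suc d)) g) n
    ≡⟨ cong (λ i → factor c (suc k) (factor c (suc i) g) n) (ℕ.+-suc k d) ⟩
  factor c (suc k) (factor c (suc (suc k ℕ.+ d)) g) n ∎
  where
  open ≡-Reasoning
  g : Series
  g = factors c (suc k) d f

-- The extra factors have the form 1 - (c q)ⁱ with i > m ≥ n, so they leave the coefficient of qⁿ
-- alone.
factors-stable : ∀ c {n m} j f → n ≤ m → factors c 0 (j ℕ.+ m) f n ≡ factors c 0 m f n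
factors-stable c         zero    f n≤m = refl
factors-stable c {n} {m} (suc j) f n≤m = begin
  g n - mono c (suc (j ℕ.+ m)) g n
    ≡⟨ cong (λ z → g n - z) (mono-< c g (s≤s (ℕ.≤-trans n≤m (ℕ.m≤n+m m j)))) ⟩
  g n - 0ℤ ≡⟨ +-identityʳ (g n) ⟩
  g n      ≡⟨ factors-stable c j f n≤m ⟩
  factors c 0 m f n ∎
  where
  open ≡-Reasoning
  g : Series
  g = factors c 0 (j ℕ.+ m) f

-- Triangular numbers, pentagonal numbers and signs.

triangle : ℕ → ℕ
triangle zero    = 0
triangle (suc k) = suc k ℕ.+ triangle k

double-triangle : ∀ k → triangle k ℕ.* 2 ≡ k ℕ.* suc k
double-triangle zero    = refl
double-triangle (suc k) = begin
  (suc k ℕ.+ triangle k) ℕ.* 2      ≡⟨ ℕ.*-distribʳ-+ 2 (suc k) (triangle k) ⟩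
  suc k ℕ.* 2 ℕ.+ triangle k ℕ.* 2  ≡⟨ cong (suc k ℕ.* 2 ℕ.+_) (double-triangle k) ⟩
  suc k ℕ.* 2 ℕ.+ k ℕ.* suc k       ≡⟨ eq k ⟩
  suc k ℕ.* suc (suc k)             ∎
  where
  open ≡-Reasoning
  eq : ∀ k → suc k ℕ.* 2 ℕ.+ k ℕ.* suc k ≡ suc k ℕ.* suc (suc k)
  eq = ℕ-solve-∀

-- This form, free of division, is the one in which the exponents of Shanks' sum appear.
pent-+ : ∀ a → pent (+ a) ≡ a ℕ.* a ℕ.+ triangle a
pent-+ a = trans (cong (_/ 2) double) (m*n/n≡m (a ℕ.* a ℕ.+ triangle a) 2)
  where
  open ≡-Reasoning
  eq : ∀ a → a ℕ.* (3 ℕ.* a ℕ.+ 1) ≡ a ℕ.* a ℕ.* 2 ℕ.+ a ℕ.* suc a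
  eq = ℕ-solve-∀
  double : a ℕ.* (3 ℕ.* a ℕ.+ 1) ≡ (a ℕ.* a ℕ.+ triangle a) ℕ.* 2
  double = begin
    a ℕ.* (3 ℕ.* a ℕ.+ 1)               ≡⟨ eq a ⟩
    a ℕ.* a ℕ.* 2 ℕ.+ a ℕ.* suc a       ≡⟨ cong (a ℕ.* a ℕ.* 2 ℕ.+_) (double-triangle a) ⟨
    a ℕ.* a ℕ.* 2 ℕ.+ triangle a ℕ.* 2  ≡⟨ ℕ.*-distribʳ-+ 2 (a ℕ.* a) (triangle a) ⟨
    (a ℕ.* a ℕ.+ triangle a) ℕ.* 2      ∎

pent-- : ∀ b → pent -[1+ b ] ≡ suc b ℕ.* suc b ℕ.+ triangle b
pent-- b = trans (cong (_/ 2) double) (m*n/n≡m (suc b ℕ.* suc b ℕ.+ triangle b) 2)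
  where
  open ≡-Reasoning
  eq : ∀ b → suc b ℕ.* (3 ℕ.* b ℕ.+ 2) ≡ suc b ℕ.* suc b ℕ.* 2 ℕ.+ b ℕ.* suc b
  eq = ℕ-solve-∀
  double : suc b ℕ.* (3 ℕ.* b ℕ.+ 2) ≡ (suc b ℕ.* suc b ℕ.+ triangle b) ℕ.* 2
  double = begin
    suc b ℕ.* (3 ℕ.* b ℕ.+ 2)                   ≡⟨ eq b ⟩
    suc b ℕ.* suc b ℕ.* 2 ℕ.+ b ℕ.* suc b       ≡⟨ cong (suc b ℕ.* suc b ℕ.* 2 ℕ.+_) (double-triangle b) ⟨
    suc b ℕ.* suc b ℕ.* 2 ℕ.+ triangle b ℕ.* 2  ≡⟨ ℕ.*-distribʳ-+ 2 (suc b ℕ.* suc b) (triangle b) ⟨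
    (suc b ℕ.* suc b ℕ.+ triangle b) ℕ.* 2      ∎

negOnePow-+ : ∀ n → negOnePow (+ n) ≡ -1ℤ ^ n
negOnePow-+ zero          = refl
negOnePow-+ (suc zero)    = refl
negOnePow-+ (suc (suc n)) = begin
  negOnePow (+ suc (suc n)) ≡⟨ periodic ⟩
  negOnePow (+ n)           ≡⟨ negOnePow-+ n ⟩
  -1ℤ ^ n                   ≡⟨ eq (-1ℤ ^ n) ⟩
  -1ℤ ^ suc (suc n)         ∎
  where
  open ≡-Reasoning
  eq : ∀ x → x ≡ -1ℤ * (-1ℤ * x)
  eq = solve-∀
  periodic : negOnePow (+ suc (suc n)) ≡ negOnePow (+ n)
  periodic with n % 2
  ... | zero  = refl
  ... | suc _ = refl

-- The argument is `- + n` because `ceilHalf` produces this form, with n = 0 possible.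
negOnePow-neg : ∀ n → negOnePow (- + n) ≡ -1ℤ ^ n
negOnePow-neg zero    = refl
negOnePow-neg (suc n) = trans even (negOnePow-+ (suc n))
  where
  even : negOnePow -[1+ n ] ≡ negOnePow (+ suc n)
  even with suc n % 2
  ... | zero  = refl
  ... | suc _ = refl

symSum-cong : ∀ N {f g} → f ≗ g → symSum N f ≡ symSum N g
symSum-cong zero    eq = eq (+ 0)
symSum-cong (suc N) eq =
  cong₂ _+_ (cong₂ _+_ (symSum-cong N eq) (eq (+ suc N))) (eq -[1+ N ])

-- Shanks' finite form of the pentagonal number theorem at c q.

module Shanks (c : ℤ) (f : Series) where

  -- The term of index k in Shanks' sum for n = k + d, applied to f.
  summand : ℕ → ℕ → Series
  summand k d n = -1ℤ ^ k * mono c ((k ℕ.+ d) ℕ.* k ℕ.+ triangle k) (factors c k d f) n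

  -- Σ_{k = 0}^{j} summand k (j + d - k); Shanks' sum is the case d = 0.
  antidiagonal : ℕ → ℕ → Series
  antidiagonal zero    d n = summand 0 d n
  antidiagonal (suc j) d n = summand (suc j) d n + antidiagonal j (suc d) n

  -- The loss of `antidiagonal j d` when d grows by one. At d = 0 the product is empty and the
  -- exponent is the pentagonal number of index -(j + 1).
  defect : ℕ → ℕ → Series
  defect j d n =
    -1ℤ ^ j * mono c (suc (j ℕ.+ d) ℕ.* suc j ℕ.+ triangle j) (factors c j d f) n

  -- Detaching the top factor of the summand and the lowest factor of the defect leaves the same
  -- product `g` in both, so only monomials acting on `g` have to be compared.
  summand-step : ∀ j d n →
    summand (suc j) (suc d) n - defect j (suc d) n ≡ summand (suc j) d n - defect (suc j) d n
  summand-step j d n = begin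
    -1ℤ * s * mono c e₁ (factor c (suc (suc j ℕ.+ d)) g) n
      - s * mono c e₂ (factors c j (suc d) f) n
      ≡⟨ cong₂ (λ x y → -1ℤ * s * x - s * y)
           (mono-factor c e₁ _ g n)
           (trans (mono-cong c e₂ (factors-lowest c j d f) n)
                  (mono-factor c e₂ (suc j) g n)) ⟩
    -1ℤ * s * (M e₁ - M (e₁ ℕ.+ suc (suc j ℕ.+ d))) - s * (M e₂ - M (e₂ ℕ.+ suc j))
      -- The second exponent of the defect equals `e₁`, so `M e₁` occurs twice with opposite signs
      -- and cancels.
      ≡⟨ cong₂ (λ x y → -1ℤ * s * (M e₁ - M x) - s * (M e₂ - M y))
           (top j d (triangle j)) (sym (cancelled j d (triangle j))) ⟩
    -1ℤ * s * (M e₁ - M e₃) - s * (M e₂ - M e₁)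
      ≡⟨ rearrange s (M e₁) (M e₂) (M e₃) ⟩
    -1ℤ * s * M e₂ - -1ℤ * s * M e₃
      ≡⟨ cong (λ x → -1ℤ * s * M x - -1ℤ * s * M e₃) (bottom j d (triangle j)) ⟩
    summand (suc j) d n - defect (suc j) d n ∎
    where
    open ≡-Reasoning
    s : ℤ
    s = -1ℤ ^ j
    g : Series
    g = factors c (suc j) d f
    M : ℕ → ℤ
    M e = mono c e g n
    e₁ e₂ e₃ : ℕ
    e₁ = (suc j ℕ.+ suc d) ℕ.* suc j ℕ.+ triangle (suc j)
    e₂ = suc (j ℕ.+ suc d) ℕ.* suc j ℕ.+ triangle j
    e₃ = suc (suc j ℕ.+ d) ℕ.* suc (suc j) ℕ.+ triangle (suc j)
    top : ∀ j d t → (suc j ℕ.+ suc d) ℕ.* suc j ℕ.+ (suc j ℕ.+ t) ℕ.+ suc (suc j ℕ.+ d)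
      ≡ suc (suc j ℕ.+ d) ℕ.* suc (suc j) ℕ.+ (suc j ℕ.+ t)
    top = ℕ-solve-∀
    cancelled : ∀ j d t → (suc j ℕ.+ suc d) ℕ.* suc j ℕ.+ (suc j ℕ.+ t)
      ≡ suc (j ℕ.+ suc d) ℕ.* suc j ℕ.+ t ℕ.+ suc j
    cancelled = ℕ-solve-∀
    bottom : ∀ j d t → suc (j ℕ.+ suc d) ℕ.* suc j ℕ.+ t
      ≡ (suc j ℕ.+ d) ℕ.* suc j ℕ.+ (suc j ℕ.+ t)
    bottom = ℕ-solve-∀
    rearrange : ∀ s x y z →
      -1ℤ * s * (x - z) - s * (y - x) ≡ -1ℤ * s * y - -1ℤ * s * z
    rearrange = solve-∀

  -- Telescoping by induction on j: the defect left by the shorter sum is exchanged by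
  -- `summand-step` for the defect of the longer one.
  antidiagonal-step : ∀ j d n →
    antidiagonal j (suc d) n ≡ antidiagonal j d n - defect j d n
  antidiagonal-step zero d n = begin
    1ℤ * mono c (suc d ℕ.* 0 ℕ.+ 0) (factor c (suc d) g) n
      ≡⟨ cong (1ℤ *_) (mono-factor c (suc d ℕ.* 0 ℕ.+ 0) (suc d) g n) ⟩
    1ℤ * (M (d ℕ.* 0 ℕ.+ 0) - M (d ℕ.* 0 ℕ.+ 0 ℕ.+ suc d))
      ≡⟨ cong (λ e → 1ℤ * (M (d ℕ.* 0 ℕ.+ 0) - M e)) (exponent d) ⟩
    1ℤ * (M (d ℕ.* 0 ℕ.+ 0) - M (suc d ℕ.* 1 ℕ.+ 0))
      ≡⟨ distrib (M (d ℕ.* 0 ℕ.+ 0)) _ ⟩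
    antidiagonal zero d n - defect zero d n ∎
    where
    open ≡-Reasoning
    g : Series
    g = factors c 0 d f
    M : ℕ → ℤ
    M e = mono c e g n
    exponent : ∀ d → d ℕ.* 0 ℕ.+ 0 ℕ.+ suc d ≡ suc d ℕ.* 1 ℕ.+ 0
    exponent = ℕ-solve-∀
    distrib : ∀ x y → 1ℤ * (x - y) ≡ 1ℤ * x - 1ℤ * y
    distrib = solve-∀
  antidiagonal-step (suc j) d n = begin
    summand (suc j) (suc d) n + antidiagonal j (suc (suc d)) n
      ≡⟨ cong (λ x → summand (suc j) (suc d) n + x) (antidiagonal-step j (suc d) n) ⟩
    summand (suc j) (suc d) n + (antidiagonal j (suc d) n - defect j (suc d) n)
      ≡⟨ swap (summand (suc j) (suc d) n) _ _ ⟩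
    (summand (suc j) (suc d) n - defect j (suc d) n) + antidiagonal j (suc d) n
      ≡⟨ cong (_+ antidiagonal j (suc d) n) (summand-step j d n) ⟩
    (summand (suc j) d n - defect (suc j) d n) + antidiagonal j (suc d) n
      ≡⟨ swap (summand (suc j) d n) _ _ ⟨
    summand (suc j) d n + (antidiagonal j (suc d) n - defect (suc j) d n)
      ≡⟨ assoc (summand (suc j) d n) _ _ ⟩
    antidiagonal (suc j) d n - defect (suc j) d n ∎
    where
    open ≡-Reasoning
    swap : ∀ x y z → x + (y - z) ≡ (x - z) + y
    swap = solve-∀
    assoc : ∀ x y z → x + (y - z) ≡ (x + y) - z
    assoc = solve-∀

  -- Passing from j to j + 1 adds a summand and subtracts a defect, both with empty products; they
  -- are the pentagonal terms of index j + 1 and -(j + 1).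
  antidiagonal-pent : ∀ j n →
    antidiagonal j 0 n ≡ symSum j (λ k → negOnePow k * mono c (pent k) f n)
  antidiagonal-pent zero    n = refl
  antidiagonal-pent (suc j) n = begin
    summand (suc j) 0 n + antidiagonal j 1 n
      ≡⟨ cong (λ x → summand (suc j) 0 n + x) (antidiagonal-step j 0 n) ⟩
    summand (suc j) 0 n + (antidiagonal j 0 n - defect j 0 n)
      ≡⟨ rearrange (summand (suc j) 0 n) (antidiagonal j 0 n) (-1ℤ ^ j)
           (M (suc (j ℕ.+ 0) ℕ.* suc j ℕ.+ triangle j)) ⟩
    antidiagonal j 0 n + summand (suc j) 0 n
      + -1ℤ ^ suc j * M (suc (j ℕ.+ 0) ℕ.* suc j ℕ.+ triangle j)
      ≡⟨ cong₂ _+_ (cong₂ _+_ (antidiagonal-pent j n)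
           (cong₂ (λ x e → x * M e) (sym (negOnePow-+ (suc j)))
             (trans (cong (λ i → i ℕ.* suc j ℕ.+ triangle (suc j)) (ℕ.+-identityʳ (suc j)))
                    (sym (pent-+ (suc j))))))
           (cong₂ (λ x e → x * M e) (sym (negOnePow-neg (suc j)))
             (trans (cong (λ i → i ℕ.* suc j ℕ.+ triangle j) (ℕ.+-identityʳ (suc j)))
                    (sym (pent-- j)))) ⟩
    symSum (suc j) (λ k → negOnePow k * mono c (pent k) f n) ∎
    where
    open ≡-Reasoning
    M : ℕ → ℤ
    M e = mono c e f n
    rearrange : ∀ w x s y → w + (x - s * y) ≡ x + w + -1ℤ * s * y
    rearrange = solve-∀

  -- A summand of index k ≥ 1 starts at an exponent greater than k + d, which is at least n. Only k
  -- = 0 contributes, and it is the full product.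
  antidiagonal-low : ∀ j d {n} → n ≤ j ℕ.+ d →
    antidiagonal j d n ≡ factors c 0 (j ℕ.+ d) f n
  antidiagonal-low zero d {n} _ = begin
    1ℤ * mono c (d ℕ.* 0 ℕ.+ 0) g n
      ≡⟨ cong (λ e → 1ℤ * mono c (e ℕ.+ 0) g n) (ℕ.*-zeroʳ d) ⟩
    1ℤ * (1ℤ * g n) ≡⟨ units (g n) ⟩
    g n             ∎
    where
    open ≡-Reasoning
    g : Series
    g = factors c 0 d f
    units : ∀ x → 1ℤ * (1ℤ * x) ≡ x
    units = solve-∀
  antidiagonal-low (suc j) d {n} n≤ = begin
    summand (suc j) d n + antidiagonal j (suc d) n
      ≡⟨ cong₂ _+_ (trans (cong (-1ℤ ^ suc j *_) (mono-< c g n<)) (*-zeroʳ (-1ℤ ^ suc j)))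
           (antidiagonal-low j (suc d) (subst (n ≤_) (sym (ℕ.+-suc j d)) n≤)) ⟩
    0ℤ + factors c 0 (j ℕ.+ suc d) f n
      ≡⟨ cong (λ i → 0ℤ + factors c 0 i f n) (ℕ.+-suc j d) ⟩
    0ℤ + factors c 0 (suc j ℕ.+ d) f n
      ≡⟨ unit _ ⟩
    factors c 0 (suc j ℕ.+ d) f n ∎
    where
    open ≡-Reasoning
    g : Series
    g = factors c (suc j) d f
    unit : ∀ x → 0ℤ + x ≡ x
    unit = solve-∀
    n< : n < (suc j ℕ.+ d) ℕ.* suc j ℕ.+ triangle (suc j)
    n< = ℕ.≤-<-trans n≤ (ℕ.≤-<-trans (ℕ.m≤m*n (suc j ℕ.+ d) (suc j)) (ℕ.m<m+n _ z<s))

  factors-pent : ∀ {n N} → n ≤ N →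
    symSum N (λ k → negOnePow k * mono c (pent k) f n) ≡ factors c 0 N f n
  factors-pent {n} {N} n≤N = begin
    symSum N (λ k → negOnePow k * mono c (pent k) f n) ≡⟨ antidiagonal-pent N n ⟨
    antidiagonal N 0 n ≡⟨ antidiagonal-low N 0 (subst (n ≤_) (sym (ℕ.+-identityʳ N)) n≤N) ⟩
    factors c 0 (N ℕ.+ 0) f n ≡⟨ cong (λ i → factors c 0 i f n) (ℕ.+-identityʳ N) ⟩
    factors c 0 N f n ∎
    where open ≡-Reasoning

-- Recurrence for overpartitions with bounded odd parts.

withPart-≥ : ∀ k p t {n} → p ≤ n →
  withPart k p (suc t) n ≡ ovOdd k (n ∸ p) ℕ.+ withPart k p t (n ∸ p)
withPart-≥ k p t {n} p≤n with p ℕ.≤? n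
... | yes _  = refl
... | no p≰n = contradiction p≤n p≰n

withPart-< : ∀ k p t {n} → n < p → withPart k p t n ≡ 0
withPart-< k p zero        n<p = refl
withPart-< k p (suc t) {n} n<p with p ℕ.≤? n
... | yes p≤n = contradiction p≤n (ℕ.<⇒≱ n<p)
... | no _    = refl

-- Each round removes at least 1 from n, so the recursion stops by itself before fuel n is exceeded.
withPart-fuel : ∀ k p s t {n} → n ≤ s → n ≤ t →
  withPart k (suc p) s n ≡ withPart k (suc p) t n
withPart-fuel k p zero    t       {zero} _ _ = sym (withPart-< k (suc p) t z<s)
withPart-fuel k p (suc s) zero    {zero} _ _ = withPart-< k (suc p) (suc s) z<s
withPart-fuel k p (suc s) (suc t) {n} n≤s n≤t with suc p ℕ.≤? n
... | no _    = refl
... | yes p<n = cong (ovOdd k (n ∸ suc p) ℕ.+_)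
  (withPart-fuel k p s t (remainder≤ p<n n≤s) (remainder≤ p<n n≤t))
  where
  remainder≤ : ∀ {n p t} → p < n → n ≤ suc t → n ∸ suc p ≤ t
  remainder≤ {suc n} {p} _ (s≤s n≤t) = ℕ.≤-trans (ℕ.m∸n≤m n p) n≤t

ovSeries : ℕ → Series
ovSeries k n = + ovOdd k n

ovOdd-< : ∀ k {n} → n < suc (2 ℕ.* k) → ovOdd (suc k) n ≡ ovOdd k n
ovOdd-< k {n} n<p = trans
  (cong (λ w → ovOdd k n ℕ.+ 2 ℕ.* w) (withPart-< k _ n n<p))
  (ℕ.+-identityʳ (ovOdd k n))

-- With p = 2k + 1 this is the coefficient form of (1 - qᵖ) Oₖ₊₁ = (1 + qᵖ) Oₖ, obtained by
-- unrolling `withPart` once.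
ovOdd-step : ∀ k {n} → suc (2 ℕ.* k) ≤ n →
  ovOdd (suc k) n ≡ ovOdd (suc k) (n ∸ suc (2 ℕ.* k)) ℕ.+ ovOdd k n ℕ.+ ovOdd k (n ∸ suc (2 ℕ.* k))
ovOdd-step k {suc n} p≤n = begin
  ovOdd k (suc n) ℕ.+ 2 ℕ.* withPart k p (suc n) (suc n)
    ≡⟨ cong (λ w → ovOdd k (suc n) ℕ.+ 2 ℕ.* w)
         (trans (withPart-≥ k p n p≤n)
                (cong (ovOdd k r ℕ.+_)
                  -- Unrolling leaves fuel `n`, whereas `ovOdd (suc k) r` runs with fuel `r`.
                  (withPart-fuel k (2 ℕ.* k) n r (ℕ.m∸n≤m n (2 ℕ.* k)) ℕ.≤-refl))) ⟩
  ovOdd k (suc n) ℕ.+ 2 ℕ.* (ovOdd k r ℕ.+ withPart k p r r)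
    ≡⟨ rearrange (ovOdd k (suc n)) (ovOdd k r) (withPart k p r r) ⟩
  ovOdd (suc k) r ℕ.+ ovOdd k (suc n) ℕ.+ ovOdd k r ∎
  where
  open ≡-Reasoning
  p r : ℕ
  p = suc (2 ℕ.* k)
  r = suc n ∸ p
  rearrange : ∀ x y w → x ℕ.+ 2 ℕ.* (y ℕ.+ w) ≡ (y ℕ.+ 2 ℕ.* w) ℕ.+ x ℕ.+ y
  rearrange = ℕ-solve-∀

-- Cancellation of the denominator of O.

-1^[2*k] : ∀ k → -1ℤ ^ (2 ℕ.* k) ≡ 1ℤ
-1^[2*k] k = trans (sym (^-*-assoc -1ℤ 2 k)) (^-zeroˡ k)

-- As 2k + 1 is odd, the numerator 1 + q^(2k+1) is 1 - (-q)^(2k+1).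
ovSeries-factor : ∀ k →
  factor 1ℤ (suc (2 ℕ.* k)) (ovSeries (suc k)) ≗ factor -1ℤ (suc (2 ℕ.* k)) (ovSeries k)
ovSeries-factor k n with ℕ.≤-<-connex (suc (2 ℕ.* k)) n
... | inj₂ n<p = cong₂ _-_ (cong +_ (ovOdd-< k n<p))
  (trans (mono-< 1ℤ (ovSeries (suc k)) n<p) (sym (mono-< -1ℤ (ovSeries k) n<p)))
... | inj₁ p≤n = begin
  + ovOdd (suc k) n - mono 1ℤ p (ovSeries (suc k)) n
    ≡⟨ cong₂ _-_ (cong +_ (ovOdd-step k p≤n))
         (trans (mono-1 p (ovSeries (suc k)) n) (shift-≥ (ovSeries (suc k)) p≤n)) ⟩
  + (ovOdd (suc k) r ℕ.+ ovOdd k n ℕ.+ ovOdd k r) - + ovOdd (suc k) r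
    ≡⟨ cong (_- + ovOdd (suc k) r)
         (trans (pos-+ (ovOdd (suc k) r ℕ.+ ovOdd k n) (ovOdd k r))
                (cong (_+ + ovOdd k r) (pos-+ (ovOdd (suc k) r) (ovOdd k n)))) ⟩
  + ovOdd (suc k) r + + ovOdd k n + + ovOdd k r - + ovOdd (suc k) r
    ≡⟨ cancel (+ ovOdd (suc k) r) (+ ovOdd k n) (+ ovOdd k r) ⟩
  + ovOdd k n - -1ℤ * 1ℤ * + ovOdd k r
    ≡⟨ cong₂ (λ x y → + ovOdd k n - -1ℤ * x * y)
         (sym (-1^[2*k] k)) (sym (shift-≥ (ovSeries k) p≤n)) ⟩
  factor -1ℤ p (ovSeries k) n ∎
  where
  open ≡-Reasoning
  p r : ℕ
  p = suc (2 ℕ.* k)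
  r = n ∸ p
  cancel : ∀ x y z → x + y + z - x ≡ y - -1ℤ * 1ℤ * z
  cancel = solve-∀

factor-even : ∀ k f → factor 1ℤ (2 ℕ.* k) f ≗ factor -1ℤ (2 ℕ.* k) f
factor-even k f n = cong (λ x → f n - x * shift (2 ℕ.* k) f n)
  (trans (^-zeroˡ (2 ℕ.* k)) (sym (-1^[2*k] k)))

-- Even factors agree at q and -q, and each odd factor passes from q to -q while removing one part
-- size, down to `ovSeries 0`, the series 1.
factors-ovSeries : ∀ k →
  factors 1ℤ 0 (2 ℕ.* k) (ovSeries k) ≗ factors -1ℤ 0 (2 ℕ.* k) (ovSeries 0)
factors-ovSeries zero    n = refl
factors-ovSeries (suc k) n = begin
  factors 1ℤ 0 (2 ℕ.* suc k) (ovSeries (suc k)) n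
    ≡⟨ unfold 1ℤ (ovSeries (suc k)) ⟩
  factor 1ℤ (2 ℕ.* suc k) (factor 1ℤ p (factors 1ℤ 0 (2 ℕ.* k) (ovSeries (suc k)))) n
    ≡⟨ factor-even (suc k) (factor 1ℤ p (factors 1ℤ 0 (2 ℕ.* k) (ovSeries (suc k)))) n ⟩
  factor -1ℤ (2 ℕ.* suc k) (factor 1ℤ p (factors 1ℤ 0 (2 ℕ.* k) (ovSeries (suc k)))) n
    ≡⟨ factor-cong -1ℤ (2 ℕ.* suc k) inner n ⟩
  factor -1ℤ (2 ℕ.* suc k) (factor -1ℤ p (factors -1ℤ 0 (2 ℕ.* k) (ovSeries 0))) n
    ≡⟨ unfold -1ℤ (ovSeries 0) ⟨
  factors -1ℤ 0 (2 ℕ.* suc k) (ovSeries 0) n ∎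
  where
  open ≡-Reasoning
  p : ℕ
  p = suc (2 ℕ.* k)
  unfold : ∀ c f → factors c 0 (2 ℕ.* suc k) f n
    ≡ factor c (2 ℕ.* suc k) (factor c p (factors c 0 (2 ℕ.* k) f)) n
  -- With the count written as 2 + 2k, both outer factors appear by computation.
  unfold c f = subst
    (λ i → factors c 0 i f n ≡ factor c i (factor c p (factors c 0 (2 ℕ.* k) f)) n)
    (sym (ℕ.*-suc 2 k)) refl
  inner : factor 1ℤ p (factors 1ℤ 0 (2 ℕ.* k) (ovSeries (suc k)))
        ≗ factor -1ℤ p (factors -1ℤ 0 (2 ℕ.* k) (ovSeries 0))
  inner i = begin
    factor 1ℤ p (factors 1ℤ 0 (2 ℕ.* k) (ovSeries (suc k))) i
      ≡⟨ factors-factor 1ℤ 0 (2 ℕ.* k) 1ℤ p (ovSeries (suc k)) i ⟨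
    factors 1ℤ 0 (2 ℕ.* k) (factor 1ℤ p (ovSeries (suc k))) i
      ≡⟨ factors-cong 1ℤ 0 (2 ℕ.* k) (ovSeries-factor k) i ⟩
    factors 1ℤ 0 (2 ℕ.* k) (factor -1ℤ p (ovSeries k)) i
      ≡⟨ factors-factor 1ℤ 0 (2 ℕ.* k) -1ℤ p (ovSeries k) i ⟩
    factor -1ℤ p (factors 1ℤ 0 (2 ℕ.* k) (ovSeries k)) i
      ≡⟨ factor-cong -1ℤ p (factors-ovSeries k) i ⟩
    factor -1ℤ p (factors -1ℤ 0 (2 ℕ.* k) (ovSeries 0)) i ∎

-- Comparison of the expansions at q and at -q.

ovOdd-stable : ∀ k {n} → n ≤ k → ovOdd k n ≡ pbarO n
ovOdd-stable zero    z≤n = refl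
ovOdd-stable (suc k) n≤k with ℕ.m≤n⇒m<n∨m≡n n≤k
... | inj₂ refl      = refl
... | inj₁ (s≤s n≤k) = trans
  (ovOdd-< k (s≤s (ℕ.≤-trans n≤k (ℕ.m≤m+n k _)))) (ovOdd-stable k n≤k)

-- The convention that negative arguments give 0 matches the zeros filled in by `shift`; for the
-- others, parts up to 2N - 1 suffice.
pbarOℤ-shift : ∀ {n N} p → n ≤ N → pbarOℤ (+ n - + p) ≡ mono 1ℤ p (ovSeries N) n
pbarOℤ-shift {n} {N} p n≤N with ℕ.≤-<-connex p n
... | inj₁ p≤n = begin
  pbarOℤ (+ n - + p)    ≡⟨ cong pbarOℤ (trans (m-n≡m⊖n n p) (⊖-≥ p≤n)) ⟩
  + pbarO (n ∸ p)       ≡⟨ cong +_ (ovOdd-stable N (ℕ.≤-trans (ℕ.m∸n≤m n p) n≤N)) ⟨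
  + ovOdd N (n ∸ p)     ≡⟨ shift-≥ (ovSeries N) p≤n ⟨
  shift p (ovSeries N) n ≡⟨ mono-1 p (ovSeries N) n ⟨
  mono 1ℤ p (ovSeries N) n ∎
  where open ≡-Reasoning
... | inj₂ n<p = begin
  pbarOℤ (+ n - + p)       ≡⟨ cong pbarOℤ (trans (m-n≡m⊖n n p) (⊖-< n<p)) ⟩
  pbarOℤ (- + (p ∸ n))     ≡⟨ negative (ℕ.m<n⇒0<n∸m n<p) ⟩
  0ℤ                       ≡⟨ mono-< 1ℤ (ovSeries N) n<p ⟨
  mono 1ℤ p (ovSeries N) n ∎
  where
  open ≡-Reasoning
  negative : ∀ {x} → 0 < x → pbarOℤ (- + x) ≡ 0ℤ
  negative (s≤s _) = refl

-- The coefficient of qⁿ in (-1)ᵏ (-q)^(k(3k+1)/2).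
signedTerm : ℕ → ℤ → ℤ
signedTerm n k = negOnePow k * mono -1ℤ (pent k) (ovSeries 0) n

symSum-term : ∀ {n N} → n ≤ N → symSum N (term n) ≡ symSum N (signedTerm n)
symSum-term {n} {N} n≤N = begin
  symSum N (term n)
    ≡⟨ symSum-cong N (λ k → cong (negOnePow k *_) (pbarOℤ-shift (pent k) n≤N)) ⟩
  symSum N (λ k → negOnePow k * mono 1ℤ (pent k) (ovSeries N) n)
    ≡⟨ Shanks.factors-pent 1ℤ (ovSeries N) n≤N ⟩
  factors 1ℤ 0 N (ovSeries N) n
    -- The exact identity needs 2N factors; since n ≤ N, the last N do not change this coefficient.
    ≡⟨ double 1ℤ (ovSeries N) ⟩
  factors 1ℤ 0 (2 ℕ.* N) (ovSeries N) n
    ≡⟨ factors-ovSeries N n ⟩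
  factors -1ℤ 0 (2 ℕ.* N) (ovSeries 0) n
    ≡⟨ double -1ℤ (ovSeries 0) ⟨
  factors -1ℤ 0 N (ovSeries 0) n
    ≡⟨ Shanks.factors-pent -1ℤ (ovSeries 0) n≤N ⟨
  symSum N (signedTerm n) ∎
  where
  open ≡-Reasoning
  double : ∀ c f → factors c 0 N f n ≡ factors c 0 (2 ℕ.* N) f n
  double c f = trans (sym (factors-stable c N f n≤N))
    (cong (λ i → factors c 0 (N ℕ.+ i) f n) (sym (ℕ.+-identityʳ N)))

signedTerm-≢ : ∀ {n} k → pent k ≢ n → signedTerm n k ≡ 0ℤ
signedTerm-≢ {n} k pent≢n = trans
  (cong (negOnePow k *_) (trans (cong (-1ℤ ^ pent k *_) (off (pent k) n pent≢n))
                                (*-zeroʳ (-1ℤ ^ pent k))))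
  (*-zeroʳ (negOnePow k))
  where
  off : ∀ p n → p ≢ n → shift p (ovSeries 0) n ≡ 0ℤ
  off zero    zero    p≢n = contradiction refl p≢n
  off zero    (suc n) p≢n = refl
  off (suc p) zero    p≢n = refl
  off (suc p) (suc n) p≢n = off p n (λ eq → p≢n (cong suc eq))

-- The sign at a pentagonal exponent.

-1^[m+m] : ∀ m → -1ℤ ^ (m ℕ.+ m) ≡ 1ℤ
-1^[m+m] m = trans (cong (λ i → -1ℤ ^ (m ℕ.+ i)) (sym (ℕ.+-identityʳ m))) (-1^[2*k] m)

-- From a to a + 2, the rounded-up half of a grows by 1 and the triangular number by 2a + 3, both
-- odd.
-1^triangle : ∀ a → -1ℤ ^ (suc a / 2) ≡ -1ℤ ^ triangle a
-1^triangle zero          = refl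
-1^triangle (suc zero)    = refl
-1^triangle (suc (suc a)) = begin
  -1ℤ ^ (suc (suc (suc a)) / 2)
    ≡⟨ cong (-1ℤ ^_) (+-distrib-/-∣ˡ (suc a) (∣-refl {2})) ⟩
  -1ℤ * -1ℤ ^ (suc a / 2)           ≡⟨ cong (-1ℤ *_) (-1^triangle a) ⟩
  -1ℤ * -1ℤ ^ triangle a            ≡⟨ *-identityˡ _ ⟨
  1ℤ * (-1ℤ * -1ℤ ^ triangle a)
    ≡⟨ cong (_* (-1ℤ ^ suc (triangle a))) (-1^[m+m] (suc a)) ⟨
  -1ℤ ^ (suc a ℕ.+ suc a) * -1ℤ ^ suc (triangle a)
    ≡⟨ ^-distribˡ-+-* -1ℤ (suc a ℕ.+ suc a) (suc (triangle a)) ⟨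
  -1ℤ ^ (suc a ℕ.+ suc a ℕ.+ suc (triangle a))
    ≡⟨ cong (-1ℤ ^_) (eq a (triangle a)) ⟩
  -1ℤ ^ triangle (suc (suc a)) ∎
  where
  open ≡-Reasoning
  eq : ∀ a t → suc a ℕ.+ suc a ℕ.+ suc t ≡ suc (suc a) ℕ.+ (suc a ℕ.+ t)
  eq = ℕ-solve-∀

-- a and a² have the same parity.
-1^square : ∀ a t → -1ℤ ^ a * -1ℤ ^ (a ℕ.* a ℕ.+ t) ≡ -1ℤ ^ t
-1^square a t = begin
  -1ℤ ^ a * -1ℤ ^ (a ℕ.* a ℕ.+ t)
    ≡⟨ ^-distribˡ-+-* -1ℤ a (a ℕ.* a ℕ.+ t) ⟨
  -1ℤ ^ (a ℕ.+ (a ℕ.* a ℕ.+ t))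
    ≡⟨ cong (-1ℤ ^_) (trans (eq a t) (cong (ℕ._+ t) (sym (double-triangle a)))) ⟩
  -1ℤ ^ (triangle a ℕ.* 2 ℕ.+ t)
    ≡⟨ ^-distribˡ-+-* -1ℤ (triangle a ℕ.* 2) t ⟩
  -1ℤ ^ (triangle a ℕ.* 2) * -1ℤ ^ t
    ≡⟨ cong (λ i → -1ℤ ^ i * -1ℤ ^ t) (ℕ.*-comm (triangle a) 2) ⟩
  -1ℤ ^ (2 ℕ.* triangle a) * -1ℤ ^ t
    ≡⟨ cong (_* -1ℤ ^ t) (-1^[2*k] (triangle a)) ⟩
  1ℤ * -1ℤ ^ t ≡⟨ *-identityˡ _ ⟩
  -1ℤ ^ t ∎
  where
  open ≡-Reasoning
  eq : ∀ a t → a ℕ.+ (a ℕ.* a ℕ.+ t) ≡ a ℕ.* suc a ℕ.+ t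
  eq = ℕ-solve-∀

negOnePow-pent : ∀ m → negOnePow m * -1ℤ ^ pent m ≡ negOnePow (ceilHalf m)
negOnePow-pent (+ a) = begin
  negOnePow (+ a) * -1ℤ ^ pent (+ a)
    ≡⟨ cong₂ (λ x e → x * -1ℤ ^ e) (negOnePow-+ a) (pent-+ a) ⟩
  -1ℤ ^ a * -1ℤ ^ (a ℕ.* a ℕ.+ triangle a) ≡⟨ -1^square a (triangle a) ⟩
  -1ℤ ^ triangle a                        ≡⟨ -1^triangle a ⟨
  -1ℤ ^ (suc a / 2)                       ≡⟨ negOnePow-+ (suc a / 2) ⟨
  negOnePow (+ (suc a / 2))               ∎
  where open ≡-Reasoning
negOnePow-pent -[1+ b ] = begin
  negOnePow -[1+ b ] * -1ℤ ^ pent -[1+ b ]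
    ≡⟨ cong₂ (λ x e → x * -1ℤ ^ e) (negOnePow-neg (suc b)) (pent-- b) ⟩
  -1ℤ ^ suc b * -1ℤ ^ (suc b ℕ.* suc b ℕ.+ triangle b) ≡⟨ -1^square (suc b) (triangle b) ⟩
  -1ℤ ^ triangle b                        ≡⟨ -1^triangle b ⟨
  -1ℤ ^ (suc b / 2)                       ≡⟨ negOnePow-neg (suc b / 2) ⟨
  negOnePow (- + (suc b / 2))             ∎
  where open ≡-Reasoning

signedTerm-pent : ∀ m → signedTerm (pent m) m ≡ negOnePow (ceilHalf m)
signedTerm-pent m = begin
  negOnePow m * (-1ℤ ^ pent m * shift (pent m) (ovSeries 0) (pent m))
    ≡⟨ cong (λ x → negOnePow m * (-1ℤ ^ pent m * x)) (diagonal (pent m)) ⟩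
  negOnePow m * (-1ℤ ^ pent m * 1ℤ)
    ≡⟨ cong (negOnePow m *_) (*-identityʳ (-1ℤ ^ pent m)) ⟩
  negOnePow m * -1ℤ ^ pent m
    ≡⟨ negOnePow-pent m ⟩
  negOnePow (ceilHalf m) ∎
  where
  open ≡-Reasoning
  diagonal : ∀ p → shift p (ovSeries 0) p ≡ 1ℤ
  diagonal zero    = refl
  diagonal (suc p) = diagonal p

-- Distinctness and growth of the pentagonal numbers.

triangle-mono-≤ : ∀ {a b} → a ≤ b → triangle a ≤ triangle b
triangle-mono-≤ z≤n       = z≤n
triangle-mono-≤ (s≤s a≤b) = s≤s (ℕ.+-mono-≤ a≤b (triangle-mono-≤ a≤b))

square-triangle-< : ∀ {a b c d} → a < b → c ≤ d →
  a ℕ.* a ℕ.+ triangle c < b ℕ.* b ℕ.+ triangle d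
square-triangle-< a<b c≤d =
  ℕ.+-mono-<-≤ (ℕ.*-mono-< a<b a<b) (triangle-mono-≤ c≤d)

-- The two families interleave: the indices 0, -1, 1, -2, 2, ... give strictly increasing values.
pent-+≢pent-- : ∀ a b → pent (+ a) ≢ pent -[1+ b ]
pent-+≢pent-- a b eq with ℕ.≤-<-connex a b
... | inj₁ a≤b = ℕ.<⇒≢ (square-triangle-< (s≤s a≤b) a≤b)
  (trans (sym (pent-+ a)) (trans eq (pent-- b)))
... | inj₂ b<a = ℕ.<⇒≢ lt (trans (sym (pent-- b)) (trans (sym eq) (pent-+ a)))
  where
  lt : suc b ℕ.* suc b ℕ.+ triangle b < a ℕ.* a ℕ.+ triangle a
  lt = ℕ.<-≤-trans (ℕ.+-monoʳ-< (suc b ℕ.* suc b) (ℕ.m<n+m (triangle b) z<s))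
    (ℕ.+-mono-≤ (ℕ.*-mono-≤ b<a b<a) (triangle-mono-≤ b<a))

pent-injective : ∀ k m → pent k ≡ pent m → k ≡ m
pent-injective (+ a) (+ b) eq with ℕ.<-cmp a b
... | tri≈ _ a≡b _ = cong +_ a≡b
... | tri< a<b _ _ = contradiction (trans (sym (pent-+ a)) (trans eq (pent-+ b)))
  (ℕ.<⇒≢ (square-triangle-< a<b (ℕ.<⇒≤ a<b)))
... | tri> _ _ b<a = contradiction (trans (sym (pent-+ b)) (trans (sym eq) (pent-+ a)))
  (ℕ.<⇒≢ (square-triangle-< b<a (ℕ.<⇒≤ b<a)))
pent-injective -[1+ a ] -[1+ b ] eq with ℕ.<-cmp a b
... | tri≈ _ a≡b _ = cong -[1+_] a≡b
... | tri< a<b _ _ = contradiction (trans (sym (pent-- a)) (trans eq (pent-- b)))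
  (ℕ.<⇒≢ (square-triangle-< (s<s a<b) (ℕ.<⇒≤ a<b)))
... | tri> _ _ b<a = contradiction (trans (sym (pent-- b)) (trans (sym eq) (pent-- a)))
  (ℕ.<⇒≢ (square-triangle-< (s<s b<a) (ℕ.<⇒≤ b<a)))
pent-injective (+ a)    -[1+ b ] eq = contradiction eq (pent-+≢pent-- a b)
pent-injective -[1+ a ] (+ b)    eq = contradiction (sym eq) (pent-+≢pent-- b a)

-- Guarantees that an index m with `pent m` ≤ N lies within the range of `symSum N`.
∣m∣≤pent : ∀ m → ∣ m ∣ ≤ pent m
∣m∣≤pent (+ zero)  = z≤n
∣m∣≤pent (+ suc a) = subst (suc a ≤_) (sym (pent-+ (suc a)))
  (ℕ.≤-trans (ℕ.m≤m*n (suc a) (suc a)) (ℕ.m≤m+n _ _))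
∣m∣≤pent -[1+ b ]  = subst (suc b ≤_) (sym (pent-- b))
  (ℕ.≤-trans (ℕ.m≤m*n (suc b) (suc b)) (ℕ.m≤m+n _ _))

-- Symmetric sums with at most one nonzero term, and the conclusion.

symSum-zero : ∀ N {f} → (∀ k → f k ≡ 0ℤ) → symSum N f ≡ 0ℤ
symSum-zero zero    f≡0 = f≡0 (+ 0)
symSum-zero (suc N) f≡0 = cong₂ _+_ (cong₂ _+_ (symSum-zero N f≡0) (f≡0 _)) (f≡0 _)

symSum-outside : ∀ N {f} m → N < ∣ m ∣ → (∀ k → k ≢ m → f k ≡ 0ℤ) → symSum N f ≡ 0ℤ
symSum-outside zero    m N<m off = off _ λ { refl → ℕ.n≮0 N<m }
symSum-outside (suc N) m N<m off =
  cong₂ _+_ (cong₂ _+_ (symSum-outside N m (ℕ.<-trans (ℕ.n<1+n N) N<m) off)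
    (off _ λ { refl → ℕ.<-irrefl refl N<m })) (off _ λ { refl → ℕ.<-irrefl refl N<m })

symSum-single : ∀ N {f} m → ∣ m ∣ ≤ N → (∀ k → k ≢ m → f k ≡ 0ℤ) → symSum N f ≡ f m
symSum-single zero    (+ zero) _ off = refl
symSum-single (suc N) {f} m m≤N off with ℕ.m≤n⇒m<n∨m≡n m≤N
... | inj₁ (s≤s m≤N) = begin
  symSum N f + f (+ suc N) + f -[1+ N ]
    ≡⟨ cong₂ _+_ (cong₂ _+_ (symSum-single N m m≤N off)
         (off _ λ { refl → ℕ.1+n≰n m≤N })) (off _ λ { refl → ℕ.1+n≰n m≤N }) ⟩
  f m + 0ℤ + 0ℤ ≡⟨ eq (f m) ⟩
  f m ∎
  where
  open ≡-Reasoning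
  eq : ∀ x → x + 0ℤ + 0ℤ ≡ x
  eq = solve-∀
symSum-single (suc N) {f} (+ suc N) m≤N off | inj₂ refl = begin
  symSum N f + f (+ suc N) + f -[1+ N ]
    ≡⟨ cong₂ (λ x y → x + f (+ suc N) + y)
         (symSum-outside N (+ suc N) (ℕ.n<1+n N) off) (off _ λ ()) ⟩
  0ℤ + f (+ suc N) + 0ℤ ≡⟨ eq (f (+ suc N)) ⟩
  f (+ suc N) ∎
  where
  open ≡-Reasoning
  eq : ∀ x → 0ℤ + x + 0ℤ ≡ x
  eq = solve-∀
symSum-single (suc N) {f} -[1+ N ] m≤N off | inj₂ refl = begin
  symSum N f + f (+ suc N) + f -[1+ N ]
    ≡⟨ cong₂ (λ x y → x + y + f -[1+ N ])
         (symSum-outside N -[1+ N ] (ℕ.n<1+n N) off) (off _ λ ()) ⟩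
  0ℤ + 0ℤ + f -[1+ N ] ≡⟨ eq (f -[1+ N ]) ⟩
  f -[1+ N ] ∎
  where
  open ≡-Reasoning
  eq : ∀ x → 0ℤ + 0ℤ + x ≡ x
  eq = solve-∀

theorem1p3 : (n : ℕ) → (N : ℕ) → n ≤ N →
    ((m : ℤ) → pent m ≡ n → symSum N (term n) ≡ negOnePow (ceilHalf m))
    × (((m : ℤ) → pent m ≢ n) → symSum N (term n) ≡ + 0)
theorem1p3 n N n≤N = pentagonal , nonpentagonal
  where
  pentagonal : (m : ℤ) → pent m ≡ n → symSum N (term n) ≡ negOnePow (ceilHalf m)
  -- Matching on `refl` makes n equal to `pent m`; by injectivity only the index m survives in the
  -- expansion at -q.
  pentagonal m refl = trans (symSum-term n≤N) (trans
    (symSum-single N m (ℕ.≤-trans (∣m∣≤pent m) n≤N)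
      (λ k k≢m → signedTerm-≢ k (λ eq → k≢m (pent-injective k m eq))))
    (signedTerm-pent m))
  nonpentagonal : ((m : ℤ) → pent m ≢ n) → symSum N (term n) ≡ + 0
  nonpentagonal none = trans (symSum-term n≤N)
    (symSum-zero N (λ k → signedTerm-≢ k (none k)))
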